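{- For every rational number $p/q \ge 1$ (with $p,q$ positive integers) there exist a finite set $D$, an integer $r\ge 1$ and a relation $R_{p,q} \subseteq D^r$ such that $\mathrm{NRD}(R_{p,q}, n) = \Theta_{p,q}(n^{p/q})$, i.e. there are constants $c_1,c_2>0$ depending only on $p,q$ with $c_1 n^{p/q}\le \mathrm{NRD}(R_{p,q},n)\le c_2 n^{p/q}$ for all sufficiently large $n$.
   Context: For a finite set $D$ and a relation $R\subseteq D^r$, an instance of $\mathrm{CSP}(R)$ is a pair $(X,Y)$ where $X$ is a finite set of variables and $Y\subseteq X^r$ is a set of clauses. An assignment $\sigma:X\to D$ satisfies a clause $y=(y_1,\dots,y_r)$ if $(\sigma(y_1),\dots,\sigma(y_r))\in R$. The instance is non-redundant if for every $y\in Y$ there is an assignment satisfying every clause in $Y\setminus\{y\}$ but not $y$. $\mathrm{NRD}(R,n)$ denotes the maximum of $|Y|$ over all non-redundant instances $(X,Y)$ of $\mathrm{CSP}(R)$ with $|X|=n$. -}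

module Defs where

open import Level using (0ℓ)
open import Data.Nat using (ℕ; _≤_)
open import Data.Fin using (Fin)
open import Data.Vec using (Vec; map)
open import Data.List using (List; length)
open import Data.List.Membership.Propositional using (_∈_)
open import Data.List.Relation.Unary.Unique.Propositional using (Unique)
open import Data.Product using (Σ; ∃; _×_)
open import Relation.Nullary using (¬_)
open import Relation.Binary.PropositionalEquality using (_≡_; _≢_)
open import Relation.Unary using (Pred)

Relation : ℕ → ℕ → Set₁
Relation d r = Pred (Vec (Fin d) r) 0ℓ

-- An instance (X, Y) of CSP(R) with X = Fin n (so |X| = n):
-- Y ⊆ X^r is a finite set of clauses, represented as a duplicate-free list.
record Instance (n r : ℕ) : Set where
  constructor inst
  field
    clauses  : List (Vec (Fin n) r)
    distinct : Unique clauses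
open Instance public

size : ∀ {n r} → Instance n r → ℕ
size I = length (clauses I)

Satisfies : ∀ {d r n} → Relation d r → (Fin n → Fin d) → Vec (Fin n) r → Set
Satisfies R σ y = R (map σ y)

NonRedundant : ∀ {d r n} → Relation d r → Instance n r → Set
NonRedundant {d} {r} {n} R I =
  ∀ y → y ∈ clauses I →
    Σ (Fin n → Fin d) λ σ →
      (¬ Satisfies R σ y) × (∀ z → z ∈ clauses I → z ≢ y → Satisfies R σ z)

IsNRD : ∀ {d r} → Relation d r → ℕ → ℕ → Set
IsNRD {d} {r} R n m =
  (Σ (Instance n r) λ I → NonRedundant R I × size I ≡ m) ×
  (∀ (I : Instance n r) → NonRedundant R I → size I ≤ m)

module Submission where

open import Defs
open import Data.Nat hiding (_≟_)
import Data.Nat as ℕ using (_≟_)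
open import Data.Nat.Properties hiding (_≟_; suc-injective)
open import Data.Nat.DivMod using (_%_; [m+n]%n≡m%n; m<n⇒m%n≡m)
open import Data.Nat.Tactic.RingSolver using (solve-∀)
open import Data.Fin
  using (Fin; zero; suc; toℕ; funToFin; finToFun; combine; remQuot; quotient; remainder; _↑ˡ_; splitAt; cast; _≟_)
open import Data.Fin.Properties
  using (finToFun-funToFin; funToFin-finToFin; injective⇒≤; remQuot-combine; any?; all?; 2↔Bool;
         splitAt-↑ˡ; cast-involutive; suc-injective; toℕ<n)
open import Data.Product using (Σ; ∃; ∃₂; _×_; _,_; proj₁; proj₂)
open import Data.Sum using (_⊎_; inj₁; inj₂; [_,_]′)
open import Data.Bool using (Bool; true; false; if_then_else_; not; _xor_; _∧_)
import Data.Bool as Bool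
open import Data.Bool.Properties
  using (xor-∧-commutativeRing; xor-same; xor-identityʳ; ∧-distribˡ-xor; ∧-zeroʳ; ∧-identityʳ; ¬-not)
open import Data.Unit using (⊤; tt)
import Data.List as List
open import Data.List.Properties using (length-tabulate)
open import Data.List.Membership.Propositional.Properties using (∈-lookup; ∈-tabulate⁻)
open import Data.List.Relation.Unary.Unique.Propositional using (Unique)
open import Data.List.Relation.Unary.Unique.Propositional.Properties using (tabulate⁺)
import Data.List.Relation.Unary.AllPairs as AllPairs
import Data.List.Relation.Unary.All as All
open import Data.Vec using (Vec; lookup; map; tabulate)
open import Data.Vec.Properties using (lookup-map; lookup∘tabulate; tabulate∘lookup; tabulate-cong; map-cong)
open import Data.Vec.Functional using (Vector; foldr; head; tail; _∷_)
open import Function using (_∘_; Inverse; Injection)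
open import Function.Properties.Inverse using (↔⇒↣)
open import Relation.Nullary using (Dec; yes; no; does; ¬_; contradiction)
open import Relation.Nullary.Decidable
  using (decidable-stable; map′; _×-dec_; _→-dec_; ¬?; dec-true; dec-false)
open import Relation.Unary using (Decidable)
open import Relation.Binary.PropositionalEquality
open import Algebra using (CommutativeRing)
open import Algebra.Properties.Semiring.Sum +-*-semiring
  using (sum; sum-cong-≗; ∑-distrib-+; ∑-comm; *-distribˡ-sum; *-distribʳ-sum)
import Algebra.Properties.Semiring.Sum (CommutativeRing.semiring xor-∧-commutativeRing) as Xor

-- The entries of a clause have p bits each, and a tuple is accepted when its entries are the
-- projections of a common nonzero v ∈ {0,1}^p onto p cyclic windows T j of length q, so that each
-- coordinate lies in exactly q windows.
--
-- Lower bound: the variables are the pairs (j, u) with u ∈ [w]^(T j), about p w^q of them, and each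
-- a ∈ [w]^p gives the clause with entries (j, a restricted to T j). The assignment sending (j, u) to
-- the bits [u i ≠ b i] violates exactly the clause of b, so w^p clauses are non-redundant.
--
-- Upper bound: if the assignment of a clause violates it because two of its entries disagree on a
-- bit, the clause is an edge of a forest on the np pairs (variable, coordinate); there are at most
-- np such clauses. Any other clause is sent to the zero tuple by its own assignment and to a
-- nonzero tuple by the others. Labelling each pair (variable, coordinate) by the bits it receives
-- under all these assignments, these clauses become distinct p-tuples whose projections to each
-- window take at most n values, and Shearer's inequality gives l^q ≤ n^p.

private variable
  d k l m n r w : ℕ

-- AM-GM and Hölder's inequality in the natural numbers.

^-distribʳ-* : ∀ m n o → (m * n) ^ o ≡ m ^ o * n ^ o
^-distribʳ-* m n zero = refl
^-distribʳ-* m n (suc o) rewrite ^-distribʳ-* m n o = interchange m n (m ^ o) (n ^ o)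
  where
  interchange : ∀ a b c d → a * b * (c * d) ≡ a * c * (b * d)
  interchange = solve-∀

2uw≤u²+w² : ∀ u w → u * w + u * w ≤ u * u + w * w
2uw≤u²+w² u w with ≤-total u w
... | inj₁ u≤w with d , refl ← m≤n⇒∃[o]m+o≡n u≤w =
  subst (u * (u + d) + u * (u + d) ≤_) (square u d) (m≤m+n _ (d * d))
  where
  square : ∀ u d → u * (u + d) + u * (u + d) + d * d ≡ u * u + (u + d) * (u + d)
  square = solve-∀
... | inj₂ w≤u with d , refl ← m≤n⇒∃[o]m+o≡n w≤u =
  subst ((w + d) * w + (w + d) * w ≤_) (square w d) (m≤m+n _ (d * d))
  where
  square : ∀ w d → (w + d) * w + (w + d) * w + d * d ≡ (w + d) * (w + d) + w * w
  square = solve-∀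

young : ∀ n u w → suc n * u ^ n * w ≤ n * u ^ suc n + w ^ suc n
young zero u w = ≤-reflexive (base w)
  where
  base : ∀ w → 1 * 1 * w ≡ w * 1
  base = solve-∀
young (suc n) u w = +-cancelʳ-≤ (n * (u * U) * w) _ _ (begin
  (2 + n) * (u * U) * w + n * (u * U) * w           ≡⟨ e₁ n u U w ⟩
  suc n * U * (u * w + u * w)                       ≤⟨ *-monoʳ-≤ (suc n * U) (2uw≤u²+w² u w) ⟩
  suc n * U * (u * u + w * w)                       ≡⟨ e₂ n u U w ⟩
  suc n * (u * (u * U)) + w * (suc n * U * w)       ≤⟨ +-monoʳ-≤ (suc n * (u * (u * U))) (*-monoʳ-≤ w (young n u w)) ⟩
  suc n * (u * (u * U)) + w * (n * (u * U) + W)     ≡⟨ e₃ n u U w W ⟩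
  suc n * (u * (u * U)) + w * W + n * (u * U) * w   ∎)
  where
  open ≤-Reasoning
  U = u ^ n
  W = w ^ suc n
  e₁ : ∀ n u U w → (2 + n) * (u * U) * w + n * (u * U) * w ≡ (1 + n) * U * (u * w + u * w)
  e₁ = solve-∀
  e₂ : ∀ n u U w → (1 + n) * U * (u * u + w * w) ≡ (1 + n) * (u * (u * U)) + w * ((1 + n) * U * w)
  e₂ = solve-∀
  e₃ : ∀ n u U w W → (1 + n) * (u * (u * U)) + w * (n * (u * U) + W)
                   ≡ (1 + n) * (u * (u * U)) + w * W + n * (u * U) * w
  e₃ = solve-∀

-- For a fixed sum `s + y` the product `s ^ n * y` is largest at `s = n * y`. This is `young` at
-- `suc n * s` and `n * (s + y)`, two numbers that coincide exactly at that maximum.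
weighted-amgm : ∀ n s y → suc n ^ suc n * (s ^ n * y) ≤ n ^ n * (s + y) ^ suc n
weighted-amgm zero s y = subst₂ _≤_ (e₁ y) (e₂ s y) (m≤n+m y s)
  where
  e₁ : ∀ y → y ≡ 1 * (1 * y)
  e₁ = solve-∀
  e₂ : ∀ s y → s + y ≡ 1 * ((s + y) * 1)
  e₂ = solve-∀
weighted-amgm n@(suc _) s y = *-cancelˡ-≤ n (+-cancelˡ-≤ (n * (suc n * s * (A * S))) _ _ (begin
  n * (suc n * s * (A * S)) + n * (suc n * A * (S * y))    ≡⟨ e₁ n s y A S ⟩
  suc n * (A * S) * (n * (s + y))                          ≡⟨ cong (λ x → suc n * x * (n * (s + y))) (^-distribʳ-* (suc n) s n) ⟨
  suc n * (suc n * s) ^ n * (n * (s + y))                  ≤⟨ young n (suc n * s) (n * (s + y)) ⟩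
  n * (suc n * s * (suc n * s) ^ n) + (n * (s + y)) ^ suc n
    ≡⟨ cong₂ (λ x z → n * (suc n * s * x) + z) (^-distribʳ-* (suc n) s n) (^-distribʳ-* n (s + y) (suc n)) ⟩
  n * (suc n * s * (A * S)) + n * n ^ n * (s + y) ^ suc n  ≡⟨ cong (n * (suc n * s * (A * S)) +_) (*-assoc n (n ^ n) _) ⟩
  n * (suc n * s * (A * S)) + n * (n ^ n * (s + y) ^ suc n) ∎))
  where
  open ≤-Reasoning
  A = suc n ^ n
  S = s ^ n
  e₁ : ∀ n s y A S → n * ((1 + n) * s * (A * S)) + n * ((1 + n) * A * (S * y)) ≡ (1 + n) * (A * S) * (n * (s + y))
  e₁ = solve-∀

prod : Vector ℕ n → ℕ
prod = foldr _*_ 1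

-- The numerator of Σ y i / S i over the common denominator prod S.
numerator : (y S : Vector ℕ n) → ℕ
numerator {zero}  y S = 0
numerator {suc n} y S = y zero * prod (tail S) + S zero * numerator (tail y) (tail S)

n^n≢0 : ∀ n → NonZero (n ^ n)
n^n≢0 zero = _
n^n≢0 (suc n) = m^n≢0 (suc n) (suc n)

-- AM-GM for the fractions y i / S i, cleared of denominators.
amgm : ∀ n (y S : Vector ℕ n) → n ^ n * (prod y * prod S ^ n) ≤ prod S * numerator y S ^ n
amgm zero y S = ≤-refl
amgm (suc n) ys Ss = *-cancelˡ-≤ (n ^ n) {{n^n≢0 n}} (begin
  n ^ n * (K * (y * Y * (S * D * (S * D) ^ n)))     ≡⟨ cong (λ x → n ^ n * (K * (y * Y * (S * D * x)))) (^-distribʳ-* S D n) ⟩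
  n ^ n * (K * (y * Y * (S * D * (S ^ n * D ^ n)))) ≡⟨ e₁ (n ^ n) K y Y S D (S ^ n) (D ^ n) ⟩
  K * y * S * D * S ^ n * (n ^ n * (Y * D ^ n))     ≤⟨ *-monoʳ-≤ (K * y * S * D * S ^ n) (amgm n (tail ys) (tail Ss)) ⟩
  K * y * S * D * S ^ n * (D * N ^ n)               ≡⟨ e₂ K y S D (S ^ n) (N ^ n) ⟩
  S * D * (K * (S ^ n * N ^ n * (y * D)))           ≡⟨ cong (λ x → S * D * (K * (x * (y * D)))) (^-distribʳ-* S N n) ⟨
  S * D * (K * ((S * N) ^ n * (y * D)))             ≤⟨ *-monoʳ-≤ (S * D) (weighted-amgm n (S * N) (y * D)) ⟩
  S * D * (n ^ n * (S * N + y * D) ^ suc n)         ≡⟨ cong (λ x → S * D * (n ^ n * x ^ suc n)) (+-comm (S * N) (y * D)) ⟩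
  S * D * (n ^ n * M ^ suc n)                       ≡⟨ e₃ (S * D) (n ^ n) (M ^ suc n) ⟩
  n ^ n * (S * D * M ^ suc n)                       ∎)
  where
  open ≤-Reasoning
  y = head ys
  S = head Ss
  Y = prod (tail ys)
  D = prod (tail Ss)
  N = numerator (tail ys) (tail Ss)
  M = y * D + S * N
  K = suc n ^ suc n
  e₁ : ∀ n K y Y S D Sn Dn → n * (K * (y * Y * (S * D * (Sn * Dn)))) ≡ K * y * S * D * Sn * (n * (Y * Dn))
  e₁ = solve-∀
  e₂ : ∀ K y S D Sn Nn → K * y * S * D * Sn * (D * Nn) ≡ S * D * (K * (Sn * Nn * (y * D)))
  e₂ = solve-∀
  e₃ : ∀ x y z → x * (y * z) ≡ y * (x * z)
  e₃ = solve-∀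

-- The last hypothesis makes c/d the larger ratio, and the mediant (a+c)/(b+d) is at most the larger
-- ratio. If d = 0, then `hc` forces c = 0.
sum-power-ratio₂ : ∀ q P a b c d → a ^ suc q ≤ P * b ^ suc q → c ^ suc q ≤ P * d ^ suc q →
                   a * d ≤ c * b → (a + c) ^ suc q ≤ P * (b + d) ^ suc q
sum-power-ratio₂ q P a b c zero ha hc _ with m^n≡0⇒m≡0 c (suc q) (n≤0⇒n≡0 (subst (c ^ suc q ≤_) (*-zeroʳ P) hc))
... | refl rewrite +-identityʳ a | +-identityʳ b = ha
sum-power-ratio₂ q P a b c d@(suc _) ha hc ad≤cb = *-cancelˡ-≤ (d ^ suc q) {{m^n≢0 d (suc q)}} (begin
  d ^ suc q * (a + c) ^ suc q        ≡⟨ ^-distribʳ-* d (a + c) (suc q) ⟨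
  (d * (a + c)) ^ suc q              ≤⟨ ^-monoˡ-≤ (suc q) step ⟩
  (c * (b + d)) ^ suc q              ≡⟨ ^-distribʳ-* c (b + d) (suc q) ⟩
  c ^ suc q * (b + d) ^ suc q        ≤⟨ *-monoˡ-≤ ((b + d) ^ suc q) hc ⟩
  P * d ^ suc q * (b + d) ^ suc q    ≡⟨ e P (d ^ suc q) ((b + d) ^ suc q) ⟩
  d ^ suc q * (P * (b + d) ^ suc q)  ∎)
  where
  open ≤-Reasoning
  e : ∀ P x y → P * x * y ≡ x * (P * y)
  e = solve-∀
  step : d * (a + c) ≤ c * (b + d)
  step = begin
    d * (a + c)    ≡⟨ *-distribˡ-+ d a c ⟩
    d * a + d * c  ≡⟨ cong₂ _+_ (*-comm d a) (*-comm d c) ⟩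
    a * d + c * d  ≤⟨ +-monoˡ-≤ (c * d) ad≤cb ⟩
    c * b + c * d  ≡⟨ *-distribˡ-+ c b d ⟨
    c * (b + d)    ∎

-- Replaces adding up `a i ≤ P^(1/(q+1)) * b i`, where the root need not be an integer; mediants are
-- taken one at a time instead.
sum-power-ratio : ∀ q P (a b : Vector ℕ n) → (∀ i → a i ^ suc q ≤ P * b i ^ suc q) →
                  sum a ^ suc q ≤ P * sum b ^ suc q
sum-power-ratio {zero} q P a b h = z≤n
sum-power-ratio {suc n} q P a b h with ≤-total (a₀ * sum b′) (sum a′ * b₀)
  where a₀ = head a ; b₀ = head b ; a′ = tail a ; b′ = tail b
... | inj₁ le = sum-power-ratio₂ q P (head a) (head b) _ _ (h zero) (sum-power-ratio q P (tail a) (tail b) (h ∘ suc)) le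
... | inj₂ le = subst₂ (λ x y → x ^ suc q ≤ P * y ^ suc q)
  (+-comm (sum (tail a)) (head a)) (+-comm (sum (tail b)) (head b))
  (sum-power-ratio₂ q P (sum (tail a)) (sum (tail b)) (head a) (head b)
    (sum-power-ratio q P (tail a) (tail b) (h ∘ suc)) (h zero) le)

sum-const : ∀ n x → sum {n} (λ _ → x) ≡ n * x
sum-const zero x = refl
sum-const (suc n) x = cong (x +_) (sum-const n x)

-- With denominators restored: for each of the n indices j the fractions `y j w / sum (y j)` add up
-- to 1 over w.
sum-numerator : ∀ (y : Vector (Vector ℕ m) n) →
                sum (λ w → numerator (λ j → y j w) (λ j → sum (y j))) ≡ n * prod (λ j → sum (y j))
sum-numerator {m} {zero} y = trans (sum-const m 0) (*-zeroʳ m)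
sum-numerator {n = suc n} y = begin
  sum (λ w → head y w * D + S * N w)            ≡⟨ ∑-distrib-+ (λ w → head y w * D) (λ w → S * N w) ⟩
  sum (λ w → head y w * D) + sum (λ w → S * N w) ≡⟨ cong₂ _+_ (*-distribʳ-sum D (head y)) (*-distribˡ-sum S N) ⟨
  S * D + S * sum N                             ≡⟨ cong (λ x → S * D + S * x) (sum-numerator (tail y)) ⟩
  S * D + S * (n * D)                           ≡⟨ e S D n ⟩
  suc n * (S * D)                               ∎
  where
  open ≡-Reasoning
  S = sum (head y)
  D = prod (λ j → sum (tail y j))
  N = λ w → numerator (λ j → tail y j w) (λ j → sum (tail y j))
  e : ∀ S D n → S * D + S * (n * D) ≡ (1 + n) * (S * D)
  e = solve-∀

prod-mono-≤ : ∀ {f g : Vector ℕ n} → (∀ i → f i ≤ g i) → prod f ≤ prod g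
prod-mono-≤ {zero} h = ≤-refl
prod-mono-≤ {suc n} h = *-mono-≤ (h zero) (prod-mono-≤ (h ∘ suc))

prod-const : ∀ n x → prod {n} (λ _ → x) ≡ x ^ n
prod-const zero x = refl
prod-const (suc n) x = cong (x *_) (prod-const n x)

prod-cong : ∀ {f g : Vector ℕ n} → (∀ i → f i ≡ g i) → prod f ≡ prod g
prod-cong {zero} h = refl
prod-cong {suc n} h = cong₂ _*_ (h zero) (prod-cong (h ∘ suc))

≤-sum : ∀ (f : Vector ℕ n) i → f i ≤ sum f
≤-sum f zero = m≤m+n _ _
≤-sum f (suc i) = ≤-trans (≤-sum (tail f) i) (m≤n+m _ _)

-- Normalising each y j by its total turns AM-GM into a bound that is linear in w.
hölder : ∀ q K (X : Vector ℕ m) (y : Vector (Vector ℕ m) (suc q)) →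
         (∀ w → X w ^ suc q ≤ K * prod (λ j → y j w)) →
         sum X ^ suc q ≤ K * prod (λ j → sum (y j))
hölder {m} q′ K X y h = go (prod S ℕ.≟ 0)
  where
  open ≤-Reasoning
  q = suc q′
  S = λ j → sum (y j)
  N = λ w → numerator (λ j → y j w) S
  e₁ : ∀ a b c d → a * b * (c * d) ≡ a * c * (b * d)
  e₁ = solve-∀
  e₂ : ∀ a D K x → a * D * (K * x) ≡ K * (a * (x * D))
  e₂ = solve-∀
  pointwise : ∀ w → (q * prod S * X w) ^ q ≤ K * prod S * N w ^ q
  pointwise w = begin
    (q * prod S * X w) ^ q                            ≡⟨ ^-distribʳ-* (q * prod S) (X w) q ⟩
    (q * prod S) ^ q * X w ^ q                        ≡⟨ cong (_* X w ^ q) (^-distribʳ-* q (prod S) q) ⟩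
    q ^ q * prod S ^ q * X w ^ q                      ≤⟨ *-monoʳ-≤ (q ^ q * prod S ^ q) (h w) ⟩
    q ^ q * prod S ^ q * (K * prod (λ j → y j w))     ≡⟨ e₂ (q ^ q) (prod S ^ q) K _ ⟩
    K * (q ^ q * (prod (λ j → y j w) * prod S ^ q))   ≤⟨ *-monoʳ-≤ K (amgm q (λ j → y j w) S) ⟩
    K * (prod S * N w ^ q)                            ≡⟨ *-assoc K (prod S) _ ⟨
    K * prod S * N w ^ q                              ∎
  -- Normalising fails when a total is 0, but then the pointwise hypothesis, bounded by
  -- `K * prod S`, makes all of X vanish.
  X≡0 : prod S ≡ 0 → ∀ w → X w ≡ 0
  X≡0 D≡0 w = m^n≡0⇒m≡0 (X w) q (n≤0⇒n≡0 (begin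
    X w ^ q                  ≤⟨ h w ⟩
    K * prod (λ j → y j w)   ≤⟨ *-monoʳ-≤ K (prod-mono-≤ (λ j → ≤-sum (y j) w)) ⟩
    K * prod S               ≡⟨ cong (K *_) D≡0 ⟩
    K * 0                    ≡⟨ *-zeroʳ K ⟩
    0                        ∎))
  D = prod S
  go : Dec (D ≡ 0) → sum X ^ q ≤ K * D
  go (yes D≡0) rewrite sum-cong-≗ (X≡0 D≡0) | sum-const m 0 | *-zeroʳ m = z≤n
  go (no D≢0) = *-cancelˡ-≤ ((q * D) ^ q) {{m^n≢0 (q * D) q {{m*n≢0 q D {{_}} {{≢-nonZero D≢0}}}}}} (begin
    (q * D) ^ q * sum X ^ q                ≡⟨ ^-distribʳ-* (q * D) (sum X) q ⟨
    (q * D * sum X) ^ q                    ≡⟨ cong (_^ q) (*-distribˡ-sum (q * D) X) ⟩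
    sum (λ w → q * D * X w) ^ q            ≤⟨ sum-power-ratio q′ (K * D) _ N pointwise ⟩
    K * D * sum N ^ q                      ≡⟨ cong (λ x → K * D * x ^ q) (sum-numerator y) ⟩
    K * D * (q * D) ^ q                    ≡⟨ *-comm (K * D) _ ⟩
    (q * D) ^ q * (K * D)                  ∎)

-- Shearer's inequality for sums over partial tuples.

indicator : Bool → ℕ
indicator b = if b then 1 else 0

count : (Fin k → Bool) → ℕ
count T = sum (indicator ∘ T)

Digit : ℕ → Bool → Set
Digit w true  = Fin w
Digit w false = ⊤

mask : ∀ b → Fin w → Digit w b
mask true  x = x
mask false x = tt

-- Coordinates outside T hold the unit type. Hence equal restrictions are propositionally equal
-- without function extensionality, and sums can peel off one coordinate at a time.
Partial : ∀ w k → (Fin k → Bool) → Set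
Partial w zero    T = ⊤
Partial w (suc k) T = Digit w (T zero) × Partial w k (T ∘ suc)

restrict : ∀ k (T : Fin k → Bool) → (Fin k → Fin w) → Partial w k T
restrict zero    T a = tt
restrict (suc k) T a = mask (T zero) (a zero) , restrict k (T ∘ suc) (a ∘ suc)

sumDigit : ∀ b → (Digit w b → ℕ) → ℕ
sumDigit true  f = sum f
sumDigit false f = f tt

sumPartial : ∀ k (T : Fin k → Bool) → (Partial w k T → ℕ) → ℕ
sumPartial zero    T f = f tt
sumPartial (suc k) T f = sumDigit (T zero) λ x → sumPartial k (T ∘ suc) λ u → f (x , u)

-- The flagged factors are moved one by one to y, the others to the constant K.
hölder-masked : ∀ q (b : Fin r → Bool) s K (X : Vector ℕ w) (y : Vector (Vector ℕ w) s)
                (Y : ∀ j → Digit w (b j) → ℕ) → s + count b ≡ suc q →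
                (∀ x → X x ^ suc q ≤ K * prod (λ j → y j x) * prod (λ j → Y j (mask (b j) x))) →
                sum X ^ suc q ≤ K * prod (λ j → sum (y j)) * prod (λ j → sumDigit (b j) (Y j))
hölder-masked {r = zero} q b s K X y Y eq h with trans (sym (+-identityʳ s)) eq
... | refl = subst (sum X ^ suc q ≤_) (sym (*-identityʳ _))
               (hölder q K X y λ x → subst (X x ^ suc q ≤_) (*-identityʳ _) (h x))
hölder-masked {r = suc r} q b s K X y Y eq h with b zero | Y zero
... | true | Y₀ = subst (sum X ^ suc q ≤_) (e K (sum Y₀) (prod λ j → sum (y j)) _)
    (hölder-masked q (b ∘ suc) (suc s) K X (Y₀ ∷ y) (λ j → Y (suc j)) (trans (sym (+-suc s _)) eq)
      λ x → subst (X x ^ suc q ≤_) (sym (e K (Y₀ x) (prod λ j → y j x) _)) (h x))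
  where
  e : ∀ K a b c → K * (a * b) * c ≡ K * b * (a * c)
  e = solve-∀
... | false | Y₀ = subst (sum X ^ suc q ≤_) (e K (Y₀ tt) (prod λ j → sum (y j)) _)
    (hölder-masked q (b ∘ suc) s (K * Y₀ tt) X y (λ j → Y (suc j)) eq
      λ x → subst (X x ^ suc q ≤_) (sym (e K (Y₀ tt) (prod λ j → y j x) _)) (h x))
  where
  e : ∀ K a b c → K * a * b * c ≡ K * b * (a * c)
  e = solve-∀

full : Fin k → Bool
full _ = true

-- A functional form of Shearer's inequality.
finner : ∀ q k (T : Fin r → Fin k → Bool) → (∀ i → count (λ j → T j i) ≡ suc q) →
         (g : Partial w k full → ℕ) (f : ∀ j → Partial w k (T j) → ℕ) →
         (∀ a → g (restrict k full a) ^ suc q ≤ prod (λ j → f j (restrict k (T j) a))) →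
         sumPartial k full g ^ suc q ≤ prod (λ j → sumPartial k (T j) (f j))
finner q zero T cover g f h = h λ ()
finner {w = w} q (suc k) T cover g f h = subst (_ ≤_) (*-identityˡ _)
  -- Hölder is applied in the first coordinate: the `suc q` windows containing it supply the factors
  -- that depend on x, the others are constants. For each fixed x the required bound is the
  -- inductive hypothesis on the remaining coordinates.
  (hölder-masked q (λ j → T j zero) 0 1 (λ x → sumPartial k full (λ u → g (x , u))) (λ ())
    (λ j x → sumPartial k (T j ∘ suc) λ u → f j (x , u)) (cover zero)
    λ x → subst (_ ≤_) (sym (*-identityˡ _))
      (finner q k (λ j → T j ∘ suc) (cover ∘ suc) (λ u → g (x , u)) (λ j u → f j (mask (T j zero) x , u))
        λ a → h (x ∷ a)))

-- From the functional inequality to counting tuples with few projections.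

δ : Fin n → Fin n → ℕ
δ x y = if does (x ≟ y) then 1 else 0

δDigit : ∀ b → Digit w b → Digit w b → ℕ
δDigit true  = δ
δDigit false _ _ = 1

δPartial : ∀ k (T : Fin k → Bool) → Partial w k T → Partial w k T → ℕ
δPartial zero    T _ _ = 1
δPartial (suc k) T (x , u) (y , v) = δDigit (T zero) x y * δPartial k (T ∘ suc) u v

sum-δ : (x : Fin n) → sum (δ x) ≡ 1
sum-δ {suc n} zero = cong suc (trans (sum-const n 0) (*-zeroʳ n))
sum-δ (suc x) = sum-δ x

sumDigit-δ : ∀ b (x : Digit w b) → sumDigit b (δDigit b x) ≡ 1
sumDigit-δ true  = sum-δ
sumDigit-δ false _ = refl

sumDigit-cong : ∀ b {f g : Digit w b → ℕ} → (∀ x → f x ≡ g x) → sumDigit b f ≡ sumDigit b g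
sumDigit-cong true  h = sum-cong-≗ h
sumDigit-cong false h = h tt

sumPartial-cong : ∀ k (T : Fin k → Bool) {f g : Partial w k T → ℕ} → (∀ u → f u ≡ g u) →
                  sumPartial k T f ≡ sumPartial k T g
sumPartial-cong zero    T h = h tt
sumPartial-cong (suc k) T h = sumDigit-cong (T zero) λ x → sumPartial-cong k (T ∘ suc) λ u → h (x , u)

*-distribʳ-sumDigit : ∀ b c (f : Digit w b → ℕ) → sumDigit b (λ x → f x * c) ≡ sumDigit b f * c
*-distribʳ-sumDigit true  c f = sym (*-distribʳ-sum c f)
*-distribʳ-sumDigit false c f = refl

*-distribʳ-sumPartial : ∀ k (T : Fin k → Bool) c (f : Partial w k T → ℕ) →
                        sumPartial k T (λ u → f u * c) ≡ sumPartial k T f * c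
*-distribʳ-sumPartial zero    T c f = refl
*-distribʳ-sumPartial (suc k) T c f =
  trans (sumDigit-cong (T zero) λ x → *-distribʳ-sumPartial k (T ∘ suc) c λ u → f (x , u))
        (*-distribʳ-sumDigit (T zero) c _)

sumPartial-δ : ∀ k (T : Fin k → Bool) (u : Partial w k T) → sumPartial k T (δPartial k T u) ≡ 1
sumPartial-δ zero    T u = refl
sumPartial-δ (suc k) T (x , u) = begin
  sumDigit (T zero) (λ y → sumPartial k (T ∘ suc) λ v → δDigit (T zero) x y * δPartial k (T ∘ suc) u v)
    ≡⟨ sumDigit-cong (T zero) (λ y → sumPartial-cong k (T ∘ suc) λ v → *-comm (δDigit (T zero) x y) _) ⟩
  sumDigit (T zero) (λ y → sumPartial k (T ∘ suc) λ v → δPartial k (T ∘ suc) u v * δDigit (T zero) x y)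
    ≡⟨ sumDigit-cong (T zero) (λ y → *-distribʳ-sumPartial k (T ∘ suc) (δDigit (T zero) x y) (δPartial k (T ∘ suc) u)) ⟩
  sumDigit (T zero) (λ y → sumPartial k (T ∘ suc) (δPartial k (T ∘ suc) u) * δDigit (T zero) x y)
    ≡⟨ sumDigit-cong (T zero) (λ y → trans (cong (_* δDigit (T zero) x y) (sumPartial-δ k (T ∘ suc) u)) (*-identityˡ _)) ⟩
  sumDigit (T zero) (δDigit (T zero) x)
    ≡⟨ sumDigit-δ (T zero) x ⟩
  1 ∎
  where open ≡-Reasoning

sumDigit-comm : ∀ b (F : Fin n → Digit w b → ℕ) →
                sumDigit b (λ x → sum λ i → F i x) ≡ sum (λ i → sumDigit b (F i))
sumDigit-comm true  F = ∑-comm λ x i → F i x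
sumDigit-comm false F = refl

sumPartial-comm : ∀ k (T : Fin k → Bool) (F : Fin n → Partial w k T → ℕ) →
                  sumPartial k T (λ u → sum λ i → F i u) ≡ sum (λ i → sumPartial k T (F i))
sumPartial-comm zero    T F = refl
sumPartial-comm (suc k) T F =
  trans (sumDigit-cong (T zero) λ x → sumPartial-comm k (T ∘ suc) λ i u → F i (x , u))
        (sumDigit-comm (T zero) λ i x → sumPartial k (T ∘ suc) λ u → F i (x , u))

-- The multiplicity of u in the family h. Its total is the size of the family, so `finner` applied
-- to multiplicities bounds cardinalities.
fibreSize : ∀ k (T : Fin k → Bool) → (Fin n → Partial w k T) → Partial w k T → ℕ
fibreSize k T h u = sum λ i → δPartial k T (h i) u

sum-fibreSize : ∀ k (T : Fin k → Bool) (h : Fin n → Partial w k T) → sumPartial k T (fibreSize k T h) ≡ n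
sum-fibreSize {n = n} k T h = begin
  sumPartial k T (fibreSize k T h)              ≡⟨ sumPartial-comm k T (λ i → δPartial k T (h i)) ⟩
  sum (λ i → sumPartial k T (δPartial k T (h i))) ≡⟨ sum-cong-≗ (λ i → sumPartial-δ k T (h i)) ⟩
  sum {n} (λ _ → 1)                             ≡⟨ trans (sum-const n 1) (*-identityʳ n) ⟩
  n                                             ∎
  where open ≡-Reasoning

δ-cases : (x y : Fin n) → (x ≡ y × δ x y ≡ 1) ⊎ δ x y ≡ 0
δ-cases x y with x ≟ y
... | yes x≡y = inj₁ (x≡y , refl)
... | no  _   = inj₂ refl

δDigit-cases : ∀ b (x y : Digit w b) → (x ≡ y × δDigit b x y ≡ 1) ⊎ δDigit b x y ≡ 0
δDigit-cases true  = δ-cases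
δDigit-cases false _ _ = inj₁ (refl , refl)

δPartial-cases : ∀ k (T : Fin k → Bool) (u v : Partial w k T) → (u ≡ v × δPartial k T u v ≡ 1) ⊎ δPartial k T u v ≡ 0
δPartial-cases zero    T u v = inj₁ (refl , refl)
δPartial-cases (suc k) T (x , u) (y , v) with δDigit-cases (T zero) x y | δPartial-cases k (T ∘ suc) u v
... | inj₁ (refl , p) | inj₁ (refl , q) rewrite p | q = inj₁ (refl , refl)
... | inj₁ (refl , p) | inj₂ q rewrite p | q = inj₂ refl
... | inj₂ p          | _      rewrite p = inj₂ refl

δDigit-refl : ∀ b (x : Digit w b) → δDigit b x x ≡ 1
δDigit-refl true x with x ≟ x
... | yes _ = refl
... | no x≢x with () ← x≢x refl
δDigit-refl false x = refl

δPartial-refl : ∀ k (T : Fin k → Bool) (u : Partial w k T) → δPartial k T u u ≡ 1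
δPartial-refl zero    T u = refl
δPartial-refl (suc k) T (x , u) rewrite δDigit-refl (T zero) x | δPartial-refl k (T ∘ suc) u = refl

fibreSize-≥1 : ∀ k (T : Fin k → Bool) (h : Fin n → Partial w k T) i → 1 ≤ fibreSize k T h (h i)
fibreSize-≥1 k T h i = subst (_≤ fibreSize k T h (h i)) (δPartial-refl k T (h i))
                               (≤-sum (λ i′ → δPartial k T (h i′) (h i)) i)

-- Multiplicities 0 and 1 are fixed by the power `suc q`, which makes the hypothesis of `finner`
-- easy to check.
fibre-injective : ∀ k (T : Fin k → Bool) (h : Fin n → Partial w k T) → (∀ {i i′} → h i ≡ h i′ → i ≡ i′) →
                  ∀ u → (∃ λ i → h i ≡ u × fibreSize k T h u ≡ 1) ⊎ fibreSize k T h u ≡ 0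
fibre-injective {n = zero} k T h inj u = inj₂ refl
fibre-injective {n = suc n} k T h inj u
  with δPartial-cases k T (h zero) u | fibre-injective k T (h ∘ suc) (suc-injective ∘ inj) u
... | inj₂ p        | inj₁ (i , e , q) rewrite p | q = inj₁ (suc i , e , refl)
... | inj₂ p        | inj₂ q rewrite p | q = inj₂ refl
... | inj₁ (e , p)  | inj₂ q rewrite p | q = inj₁ (zero , e , refl)
... | inj₁ (e , p)  | inj₁ (i , e′ , q) with () ← inj (trans e (sym e′))

-- `finner` with g the multiplicity in the m tuples and `f j` the multiplicity in the n values of
-- `v j`. Wherever g is 1, every projection is hit by some `v j x`, so every factor on the right is
-- at least 1.
loomis-whitney : ∀ q k (T : Fin r → Fin k → Bool) → (∀ i → count (λ j → T j i) ≡ suc q) →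
                 (a : Fin m → Fin k → Fin w) (v : ∀ j → Fin n → Partial w k (T j)) →
                 (∀ {c c′} → restrict k full (a c) ≡ restrict k full (a c′) → c ≡ c′) →
                 (∀ c j → ∃ λ x → v j x ≡ restrict k (T j) (a c)) →
                 m ^ suc q ≤ n ^ r
loomis-whitney {r} {m} {w} {n} q k T cover a v inj proj = subst₂ (λ x y → x ^ suc q ≤ y)
  (sum-fibreSize k full h)
  (trans (prod-cong (λ j → sum-fibreSize k (T j) (v j))) (prod-const r n))
  (finner q k T cover (fibreSize k full h) (λ j → fibreSize k (T j) (v j)) pointwise)
  where
  h : Fin m → Partial w k full
  h c = restrict k full (a c)
  restrict-full : ∀ k (T : Fin k → Bool) {b b′ : Fin k → Fin w} → restrict k full b ≡ restrict k full b′ →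
                  restrict k T b ≡ restrict k T b′
  restrict-full zero T e = refl
  restrict-full (suc k) T e = cong₂ _,_ (cong (mask (T zero)) (cong proj₁ e)) (restrict-full k (T ∘ suc) (cong proj₂ e))
  pointwise : ∀ b → fibreSize k full h (restrict k full b) ^ suc q ≤ prod λ j → fibreSize k (T j) (v j) (restrict k (T j) b)
  pointwise b with fibre-injective k full h inj (restrict k full b)
  ... | inj₂ p rewrite p = z≤n
  ... | inj₁ (c , e , p) rewrite p | ^-zeroˡ q =
    subst (_≤ prod λ j → fibreSize k (T j) (v j) (restrict k (T j) b)) (trans (prod-const r 1) (^-zeroˡ r)) (prod-mono-≤ λ j →
      let x , e′ = proj c j in
      subst (λ u → 1 ≤ fibreSize k (T j) (v j) u) (trans e′ (restrict-full k (T j) e)) (fibreSize-≥1 k (T j) (v j) x))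

-- Codes for bit vectors, and the forest bound over the two-element field.

funToFin-cong : {f g : Fin m → Fin n} → f ≗ g → funToFin f ≡ funToFin g
funToFin-cong {zero}  h = refl
funToFin-cong {suc m} h = cong₂ combine (h zero) (funToFin-cong (h ∘ suc))

finToFun-injective : {s t : Fin (n ^ m)} → finToFun {n} {m} s ≗ finToFun t → s ≡ t
finToFun-injective {n} {m} {s} {t} h =
  trans (sym (funToFin-finToFin {m} {n} s)) (trans (funToFin-cong h) (funToFin-finToFin {m} {n} t))

pack : (Fin k → Bool) → Fin (2 ^ k)
pack f = funToFin (Inverse.from 2↔Bool ∘ f)

unpack : Fin (2 ^ k) → Fin k → Bool
unpack s i = Inverse.to 2↔Bool (finToFun s i)

unpack-pack : (f : Fin k → Bool) → unpack (pack f) ≗ f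
unpack-pack f i = trans (cong (Inverse.to 2↔Bool) (finToFun-funToFin (Inverse.from 2↔Bool ∘ f) i))
                        (Inverse.strictlyInverseˡ 2↔Bool (f i))

pack-cong : {f g : Fin k → Bool} → f ≗ g → pack f ≡ pack g
pack-cong h = funToFin-cong (cong (Inverse.from 2↔Bool) ∘ h)

unpack-injective : {s t : Fin (2 ^ k)} → unpack s ≗ unpack t → s ≡ t
unpack-injective {k} h = finToFun-injective {2} {k} λ i → Injection.injective (↔⇒↣ 2↔Bool) (h i)

^-cancelʳ-≤ : ∀ m n → 2 ^ m ≤ 2 ^ n → m ≤ n
^-cancelʳ-≤ m n h with ≤-<-connex m n
... | inj₁ m≤n = m≤n
... | inj₂ n<m with () ← <⇒≱ (^-monoʳ-< 2 (s≤s (s≤s z≤n)) n<m) h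

xor-sum-single : (h : Fin n → Bool) (c : Fin n) → (∀ c′ → c′ ≢ c → h c′ ≡ false) → Xor.sum h ≡ h c
xor-sum-single {suc n} h zero    z =
  trans (cong (h zero xor_) (trans (Xor.sum-cong-≗ λ i → z (suc i) λ ()) (Xor.sum-replicate-zero n))) (xor-identityʳ _)
xor-sum-single h (suc c) z =
  trans (cong (_xor Xor.sum (h ∘ suc)) (z zero λ ())) (xor-sum-single (h ∘ suc) c λ c′ ne → z (suc c′) (ne ∘ suc-injective))

-- The pairs (u c, v c) are the edges of a forest on m vertices. The bound k ≤ m is obtained from
-- the injectivity of the map A ↦ ⊕_{c ∈ A} f c from subsets of Fin k to subsets of Fin m.
separated-pairs : (f : Fin k → Fin m → Bool) (u v : Fin k → Fin m) →
                  (∀ c → f c (u c) ≢ f c (v c)) →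
                  (∀ c c′ → c′ ≢ c → f c (u c′) ≡ f c (v c′)) → k ≤ m
separated-pairs {k} {m} f u v sep agree = ^-cancelʳ-≤ k m (injective⇒≤ φ-injective)
  where
  combination : (Fin k → Bool) → Fin m → Bool
  combination A x = Xor.sum λ c → A c ∧ f c x
  φ : Fin (2 ^ k) → Fin (2 ^ m)
  φ s = pack (combination (unpack s))
  ≢⇒xor : ∀ x y → x ≢ y → x xor y ≡ true
  ≢⇒xor true  y ne = sym (¬-not ne)
  ≢⇒xor false y ne = ¬-not (ne ∘ sym)
  -- Adding the values at the two ends of edge c cancels every `f c′` with `c′ ≢ c`, since `f c′`
  -- agrees there; what remains is the membership bit of c in A.
  recover : ∀ A c → combination A (u c) xor combination A (v c) ≡ A c
  recover A c = begin
    combination A (u c) xor combination A (v c)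
      ≡⟨ Xor.∑-distrib-+ (λ c′ → A c′ ∧ f c′ (u c)) _ ⟨
    Xor.sum (λ c′ → (A c′ ∧ f c′ (u c)) xor (A c′ ∧ f c′ (v c)))
      ≡⟨ Xor.sum-cong-≗ (λ c′ → ∧-distribˡ-xor (A c′) _ _) ⟨
    Xor.sum (λ c′ → A c′ ∧ (f c′ (u c) xor f c′ (v c)))
      ≡⟨ xor-sum-single _ c (λ c′ ne → trans
           (cong (λ x → A c′ ∧ (x xor f c′ (v c))) (agree c′ c (ne ∘ sym)))
           (trans (cong (A c′ ∧_) (xor-same (f c′ (v c)))) (∧-zeroʳ _))) ⟩
    A c ∧ (f c (u c) xor f c (v c))
      ≡⟨ cong (A c ∧_) (≢⇒xor _ _ (sep c)) ⟩
    A c ∧ true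
      ≡⟨ ∧-identityʳ _ ⟩
    A c ∎
    where open ≡-Reasoning
  φ-injective : ∀ {s t} → φ s ≡ φ t → s ≡ t
  φ-injective {s} {t} e = unpack-injective λ c →
    trans (sym (recover (unpack s) c)) (trans (cong₂ _xor_ (same (u c)) (same (v c))) (recover (unpack t) c))
    where
    same : combination (unpack s) ≗ combination (unpack t)
    same x = trans (sym (unpack-pack _ x)) (trans (cong (λ z → unpack z x) e) (unpack-pack _ x))

-- Subfamilies, independent families and restrictions.

-- A subset re-indexed by `Fin a`, so that bounds on families indexed by `Fin` apply to each class
-- of a partition.
Selection : ℕ → (Fin l → Set) → Set
Selection {l} a P = Σ (Fin a → Fin l) λ e → (∀ {i j} → e i ≡ e j → i ≡ j) × ∀ i → P (e i)

shift : ∀ {a} (P : Fin (suc l) → Set) → Selection a (P ∘ suc) → Selection a P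
shift P (e , inj , h) = suc ∘ e , inj ∘ suc-injective , h

extend : ∀ {a} (P : Fin (suc l) → Set) → P zero → Selection a (P ∘ suc) → Selection (suc a) P
extend {l} {a} P p (e , inj , h) = e′ , inj′ , h′
  where
  e′ : Fin (suc a) → Fin (suc l)
  e′ zero = zero
  e′ (suc i) = suc (e i)
  inj′ : ∀ {i j} → e′ i ≡ e′ j → i ≡ j
  inj′ {zero} {zero} _ = refl
  inj′ {suc i} {suc j} eq = cong suc (inj (suc-injective eq))
  h′ : ∀ i → P (e′ i)
  h′ zero = p
  h′ (suc i) = h i

partition : {P Q : Fin l → Set} → (∀ i → P i ⊎ Q i) → ∃₂ λ a b → a + b ≡ l × Selection a P × Selection b Q
partition {zero} h = 0 , 0 , refl , ((λ ()) , (λ {}) , λ ()) , ((λ ()) , (λ {}) , λ ())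
partition {suc l} {P} {Q} h with h zero | partition (h ∘ suc)
... | inj₁ p | a , b , eq , s , t = suc a , b , cong suc eq , extend P p s , shift Q t
... | inj₂ q | a , b , eq , s , t = a , suc b , trans (+-suc a b) (cong suc eq) , shift P s , extend Q q t

-- The clauses of an independent family are automatically distinct.
Independent : Relation d r → (Fin l → Vec (Fin n) r) → Set
Independent {d} {n = n} R y = ∀ c → Σ (Fin n → Fin d) λ σ →
  ¬ Satisfies R σ (y c) × (∀ c′ → c′ ≢ c → Satisfies R σ (y c′))

count-witness : ∀ q (b : Fin k → Bool) → count b ≡ suc q → ∃ λ j → b j ≡ true
count-witness {suc k} q b e with b zero in eq
... | true = zero , eq
... | false with j , h ← count-witness q (b ∘ suc) e = suc j , h

mask-cong : ∀ b {x y : Fin w} → (b ≡ true → x ≡ y) → mask b x ≡ mask b y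
mask-cong true  h = h refl
mask-cong false h = refl

restrict-cong : ∀ k (T : Fin k → Bool) {a b : Fin k → Fin w} → (∀ i → T i ≡ true → a i ≡ b i) →
                restrict k T a ≡ restrict k T b
restrict-cong zero    T h = refl
restrict-cong (suc k) T h = cong₂ _,_ (mask-cong (T zero) (h zero)) (restrict-cong k (T ∘ suc) (h ∘ suc))

restrict-full-injective : ∀ k {a b : Fin k → Fin w} → restrict k full a ≡ restrict k full b → a ≗ b
restrict-full-injective (suc k) e zero    = cong proj₁ e
restrict-full-injective (suc k) e (suc i) = restrict-full-injective k (cong proj₂ e) i

-- The relation and the upper bound for independent families.

module Masked {r k} (T : Fin r → Fin k → Bool) where

  Conflict : Relation (2 ^ k) r
  Conflict t = ∃ λ j → ∃ λ j′ → ∃ λ i → T j i ≡ true × T j′ i ≡ true ×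
    unpack (lookup t j) i ≢ unpack (lookup t j′) i

  NonZeroTuple : Relation (2 ^ k) r
  NonZeroTuple t = ∃ λ j → ∃ λ i → T j i ≡ true × unpack (lookup t j) i ≡ true

  -- The nonzero elements of the linear subspace of tuples whose entries are the
  -- projections of a common vector of k bits onto the coordinate sets T j.
  Projections : Relation (2 ^ k) r
  Projections t = ¬ Conflict t × NonZeroTuple t

  conflict? : Decidable Conflict
  conflict? t = any? λ j → any? λ j′ → any? λ i → (T j i Bool.≟ true) ×-dec (T j′ i Bool.≟ true) ×-dec
    ¬? (unpack (lookup t j) i Bool.≟ unpack (lookup t j′) i)

  projections? : Decidable Projections
  projections? t = ¬? (conflict? t) ×-dec
    any? λ j → any? λ i → (T j i Bool.≟ true) ×-dec (unpack (lookup t j) i Bool.≟ true)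

  bit : (Fin n → Fin (2 ^ k)) → Vec (Fin n) r → Fin r → Fin k → Bool
  bit σ y j i = unpack (σ (lookup y j)) i

  bit-map : (σ : Fin n → Fin (2 ^ k)) (y : Vec (Fin n) r) → ∀ j i → unpack (lookup (map σ y) j) i ≡ bit σ y j i
  bit-map σ y j i = cong (λ s → unpack s i) (lookup-map j σ y)

  agree : (σ : Fin n → Fin (2 ^ k)) (y : Vec (Fin n) r) → ¬ Conflict (map σ y) →
          ∀ {j j′ i} → T j i ≡ true → T j′ i ≡ true → bit σ y j i ≡ bit σ y j′ i
  agree σ y nc {j} {j′} {i} h h′ = decidable-stable (_ Bool.≟ _) λ ne →
    nc (j , j′ , i , h , h′ , λ e → ne (trans (sym (bit-map σ y j i)) (trans e (bit-map σ y j′ i))))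

  -- In `separated-pairs` the function `f c` gives the bits of `σ c` at all pairs (variable,
  -- coordinate). A conflict of clause c names two such pairs: `σ c` separates them, while the
  -- assignments of the other clauses do not.
  conflicting-≤ : (y : Fin l → Vec (Fin n) r) (σ : Fin l → Fin n → Fin (2 ^ k)) →
                  (∀ c → Conflict (map (σ c) (y c))) →
                  (∀ c c′ → c′ ≢ c → ¬ Conflict (map (σ c) (y c′))) → l ≤ n * k
  conflicting-≤ {n = n} y σ conf agr = separated-pairs
    (λ c z → unpack (σ c (quotient k z)) (remainder {n} k z))
    (λ c → combine (lookup (y c) (j₁ c)) (i c)) (λ c → combine (lookup (y c) (j₂ c)) (i c))
    (λ c e → proj₂ (proj₂ (proj₂ (proj₂ (proj₂ (conf c)))))
      (trans (bit-map (σ c) (y c) (j₁ c) (i c)) (trans (sym (at c _ _)) (trans e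
        (trans (at c _ _) (sym (bit-map (σ c) (y c) (j₂ c) (i c))))))))
    (λ c c′ ne → let _ , _ , _ , h , h′ , _ = conf c′ in
      trans (at c _ _) (trans (agree (σ c) (y c′) (agr c c′ ne) h h′) (sym (at c _ _))))
    where
    j₁ = λ c → proj₁ (conf c)
    j₂ = λ c → proj₁ (proj₂ (conf c))
    i = λ c → proj₁ (proj₂ (proj₂ (conf c)))
    at : ∀ c x i → unpack (σ c (quotient k (combine x i))) (remainder {n} k (combine x i)) ≡ unpack (σ c x) i
    at c x i = cong (λ { (x′ , i′) → unpack (σ c x′) i′ }) (remQuot-combine x i)

  -- The label of a variable in coordinate i collects its i-th bits under all the assignments.
  consistent-≤ : ∀ q → (∀ i → count (λ j → T j i) ≡ suc q) →
                 (y : Fin l → Vec (Fin n) r) (σ : Fin l → Fin n → Fin (2 ^ k)) →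
                 (∀ c → ¬ NonZeroTuple (map (σ c) (y c))) →
                 (∀ c c′ → ¬ Conflict (map (σ c) (y c′))) →
                 (∀ c c′ → c′ ≢ c → NonZeroTuple (map (σ c) (y c′))) → l ^ suc q ≤ n ^ r
  consistent-≤ {l} {n} q cover y σ zeroes agr nonzero =
    loomis-whitney q k T cover tuple (λ j x → restrict k (T j) (label x)) tuple-injective
      -- Each coordinate of a tuple is read through one chosen window. Without conflicts any window
      -- containing the coordinate shows the same label, so the projection to `T j` comes from the
      -- j-th variable of the clause.
      λ c j → lookup (y c) j , restrict-cong k (T j) λ i h → pack-cong λ c′ →
        agree (σ c′) (y c) (agr c′ c) h (proj₂ (covered i))
    where
    covered : ∀ i → ∃ λ j → T j i ≡ true
    covered i = count-witness q _ (cover i)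
    label : Fin n → Fin k → Fin (2 ^ l)
    label x i = pack λ c → unpack (σ c x) i
    tuple : Fin l → Fin k → Fin (2 ^ l)
    tuple c i = label (lookup (y c) (proj₁ (covered i))) i
    tuple-injective : ∀ {c c′} → restrict k full (tuple c) ≡ restrict k full (tuple c′) → c ≡ c′
    tuple-injective {c} {c′} e with c ≟ c′
    ... | yes c≡c′ = c≡c′
    -- Bit c of a label records the assignment of c, which makes some bit of clause c′ true. Equal
    -- tuples would carry this true bit over to clause c, which that assignment sends to zero.
    ... | no c≢c′ with j , i , h , b ← nonzero c c′ (c≢c′ ∘ sym) = contradiction (j₀ , i , h₀ , bit-c≡true) (zeroes c)
      where
      open ≡-Reasoning
      j₀ = proj₁ (covered i)
      h₀ = proj₂ (covered i)
      bit-c≡true : unpack (lookup (map (σ c) (y c)) j₀) i ≡ true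
      bit-c≡true = begin
        unpack (lookup (map (σ c) (y c)) j₀) i    ≡⟨ bit-map (σ c) (y c) j₀ i ⟩
        bit (σ c) (y c) j₀ i                      ≡⟨ unpack-pack _ c ⟨
        unpack (tuple c i) c                      ≡⟨ cong (λ z → unpack z c) (restrict-full-injective k e i) ⟩
        unpack (tuple c′ i) c                     ≡⟨ unpack-pack _ c ⟩
        bit (σ c) (y c′) j₀ i                     ≡⟨ agree (σ c) (y c′) (agr c c′) h₀ h ⟩
        bit (σ c) (y c′) j i                      ≡⟨ bit-map (σ c) (y c′) j i ⟨
        unpack (lookup (map (σ c) (y c′)) j) i    ≡⟨ b ⟩
        true                                      ∎

  independent-≤ : ∀ q → (∀ i → count (λ j → T j i) ≡ suc q) →
                  (y : Fin l → Vec (Fin n) r) → Independent Projections y →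
                  ∃₂ λ a b → a + b ≡ l × a ≤ n * k × b ^ suc q ≤ n ^ r
  independent-≤ {n = n} q cover y ind = bounds
    where
    σ = λ c → proj₁ (ind c)
    sat : ∀ c c′ → c′ ≢ c → Projections (map (σ c) (y c′))
    sat c = proj₂ (proj₂ (ind c))
    dichotomy : ∀ c → Conflict (map (σ c) (y c)) ⊎ ¬ Conflict (map (σ c) (y c))
    dichotomy c with conflict? (map (σ c) (y c))
    ... | yes p = inj₁ p
    ... | no ¬p = inj₂ ¬p
    bounds : ∃₂ λ a b → a + b ≡ _ × a ≤ n * k × b ^ suc q ≤ n ^ r
    bounds with a , b , eq , (e , e-inj , conf) , (e′ , e′-inj , noconf) ← partition dichotomy =
      a , b , eq
      , conflicting-≤ (y ∘ e) (σ ∘ e) conf (λ c c′ ne → proj₁ (sat (e c) (e c′) (ne ∘ e-inj)))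
      , consistent-≤ q cover (y ∘ e′) (σ ∘ e′)
          (λ c nz → proj₁ (proj₂ (ind (e′ c))) (noconf c , nz))
          (λ c c′ → case-≡ c c′ (c′ ≟ c))
          (λ c c′ ne → proj₂ (sat (e′ c) (e′ c′) (ne ∘ e′-inj)))
      where
      -- A clause has no conflict under its own assignment by the choice of the class, and none
      -- under the others because they satisfy it.
      case-≡ : ∀ c c′ → Dec (c′ ≡ c) → ¬ Conflict (map (σ (e′ c)) (y (e′ c′)))
      case-≡ c c′ (yes refl) = noconf c
      case-≡ c c′ (no ne)    = proj₁ (sat (e′ c) (e′ c′) (ne ∘ e′-inj))

-- The grid instance for the lower bound.

-- The exponent `indicator b + c` is what `count` unfolds to, so `encode` recurses without
-- transport.
encodeDigit : ∀ b {c} → Digit w b → Fin (w ^ c) → Fin (w ^ (indicator b + c))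
encodeDigit true  x z = combine x z
encodeDigit false x z = z

decodeDigit : ∀ b {c} → Fin (w ^ (indicator b + c)) → Digit w b × Fin (w ^ c)
decodeDigit {w} true {c} z = remQuot {w} (w ^ c) z
decodeDigit     false z = tt , z

decode-encodeDigit : ∀ b {c} (x : Digit w b) (z : Fin (w ^ c)) → decodeDigit b {c} (encodeDigit b {c} x z) ≡ (x , z)
decode-encodeDigit true  x z = remQuot-combine x z
decode-encodeDigit false x z = refl

encode : ∀ k (T : Fin k → Bool) → Partial w k T → Fin (w ^ count T)
encode zero    T u = zero
encode (suc k) T (x , u) = encodeDigit (T zero) x (encode k (T ∘ suc) u)

decode : ∀ k (T : Fin k → Bool) → Fin (w ^ count T) → Partial w k T
decode zero    T z = tt
decode {w} (suc k) T z = let x , z′ = decodeDigit {w} (T zero) {count (T ∘ suc)} z in x , decode k (T ∘ suc) z′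

decode-encode : ∀ k (T : Fin k → Bool) (u : Partial w k T) → decode k T (encode k T u) ≡ u
decode-encode zero    T u = refl
decode-encode (suc k) T (x , u) =
  trans (cong (λ (x′ , z) → x′ , decode k (T ∘ suc) z) (decode-encodeDigit (T zero) x (encode k (T ∘ suc) u)))
        (cong (x ,_) (decode-encode k (T ∘ suc) u))

fillDigit : ∀ b → Digit w b → Fin w → Fin w
fillDigit true  x y = x
fillDigit false x y = y

fill : ∀ k (T : Fin k → Bool) → Partial w k T → (Fin k → Fin w) → Fin k → Fin w
fill (suc k) T (x , u) b zero    = fillDigit (T zero) x (b zero)
fill (suc k) T (x , u) b (suc i) = fill k (T ∘ suc) u (b ∘ suc) i

fillDigit-mask : ∀ b (x y : Fin w) → b ≡ true → fillDigit b (mask b x) y ≡ x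
fillDigit-mask true x y refl = refl

fill-restrict : ∀ k (T : Fin k → Bool) (a b : Fin k → Fin w) i → T i ≡ true → fill k T (restrict k T a) b i ≡ a i
fill-restrict (suc k) T a b zero    h = fillDigit-mask (T zero) (a zero) (b zero) h
fill-restrict (suc k) T a b (suc i) h = fill-restrict k (T ∘ suc) (a ∘ suc) (b ∘ suc) i h

module _ {r k} (T : Fin r → Fin k → Bool) where
  open Masked T

  module _ {q} (size-T : ∀ j → count (T j) ≡ q) (covered : ∀ i → ∃ λ j → T j i ≡ true) (w e : ℕ) where

    -- The last e variables occur in no clause.
    variableAt : Fin r → (Fin k → Fin w) → Fin (r * w ^ q + e)
    variableAt j a = combine j (cast (cong (w ^_) (size-T j)) (encode k (T j) (restrict k (T j) a))) ↑ˡ e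

    clauseOf : (Fin k → Fin w) → Vec (Fin (r * w ^ q + e)) r
    clauseOf a = tabulate λ j → variableAt j a

    -- The default passed to `fill` is b itself, so bits outside the window come out false.
    differences : ∀ j → (Fin k → Fin w) → Fin (w ^ q) → Fin (2 ^ k)
    differences j b z = pack λ i →
      not (does (fill k (T j) (decode k (T j) (cast (cong (w ^_) (sym (size-T j))) z)) b i ≟ b i))

    assignment : (Fin k → Fin w) → Fin (r * w ^ q + e) → Fin (2 ^ k)
    -- Padding variables receive the zero vector as a default.
    assignment b x = [ (λ z → differences (quotient (w ^ q) z) b (remainder {r} (w ^ q) z)) , (λ _ → pack {k} λ _ → false) ]′
                       (splitAt (r * w ^ q) x)

    assignment-variableAt : ∀ b j a i → T j i ≡ true →
                            unpack (assignment b (variableAt j a)) i ≡ not (does (a i ≟ b i))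
    assignment-variableAt b j a i h = begin
      unpack (assignment b (variableAt j a)) i
        ≡⟨ cong (λ z → unpack ([ _ , _ ]′ z) i) (splitAt-↑ˡ (r * w ^ q) (combine j code) e) ⟩
      unpack (differences (quotient (w ^ q) (combine j code)) b (remainder {r} (w ^ q) (combine j code))) i
        ≡⟨ cong (λ (j′ , z) → unpack (differences j′ b z) i) (remQuot-combine j code) ⟩
      unpack (differences j b code) i
        ≡⟨ unpack-pack _ i ⟩
      not (does (fill k (T j) (decode k (T j) (cast _ code)) b i ≟ b i))
        ≡⟨ cong (λ z → not (does (fill k (T j) (decode k (T j) z) b i ≟ b i)))
             (cast-involutive (cong (w ^_) (sym (size-T j))) (cong (w ^_) (size-T j)) (encode k (T j) u)) ⟩
      not (does (fill k (T j) (decode k (T j) (encode k (T j) u)) b i ≟ b i))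
        ≡⟨ cong (λ v → not (does (fill k (T j) v b i ≟ b i))) (decode-encode k (T j) u) ⟩
      not (does (fill k (T j) u b i ≟ b i))
        ≡⟨ cong (λ x → not (does (x ≟ b i))) (fill-restrict k (T j) a b i h) ⟩
      not (does (a i ≟ b i)) ∎
      where
      open ≡-Reasoning
      u = restrict k (T j) a
      code = cast (cong (w ^_) (size-T j)) (encode k (T j) u)

    unpack-clauseOf : ∀ b a j i → T j i ≡ true →
                      unpack (lookup (map (assignment b) (clauseOf a)) j) i ≡ not (does (a i ≟ b i))
    unpack-clauseOf b a j i h = begin
      unpack (lookup (map (assignment b) (clauseOf a)) j) i  ≡⟨ bit-map (assignment b) (clauseOf a) j i ⟩
      unpack (assignment b (lookup (clauseOf a) j)) i        ≡⟨ cong (λ x → unpack (assignment b x) i) (lookup∘tabulate _ j) ⟩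
      unpack (assignment b (variableAt j a)) i               ≡⟨ assignment-variableAt b j a i h ⟩
      not (does (a i ≟ b i))                                 ∎
      where open ≡-Reasoning

    -- All windows see parts of the single vector [a i ≠ b i], so no conflict arises. If a and b
    -- differ at i, a window covering i shows a true bit; if a = b, every visible bit is false.
    grid-independent : Independent Projections (λ (c : Fin (w ^ k)) → clauseOf (finToFun c))
    grid-independent c = assignment b , violated , satisfied
      where
      b = finToFun c
      violated : ¬ Projections (map (assignment b) (clauseOf b))
      violated (_ , j , i , h , bit≡true)
        with () ← trans (sym bit≡true) (trans (unpack-clauseOf b b j i h) (cong not (dec-true (b i ≟ b i) refl)))
      satisfied : ∀ c′ → c′ ≢ c → Projections (map (assignment b) (clauseOf (finToFun c′)))
      satisfied c′ c′≢c = noConflict , nonzero (any? λ i → ¬? (a i ≟ b i))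
        where
        a = finToFun c′
        noConflict : ¬ Conflict (map (assignment b) (clauseOf a))
        noConflict (j , j′ , i , h , h′ , ne) = ne (trans (unpack-clauseOf b a j i h) (sym (unpack-clauseOf b a j′ i h′)))
        nonzero : Dec (∃ λ i → a i ≢ b i) → NonZeroTuple (map (assignment b) (clauseOf a))
        nonzero (yes (i , ne)) = let j , h = covered i in
          j , i , h , trans (unpack-clauseOf b a j i h) (cong not (dec-false (a i ≟ b i) ne))
        nonzero (no ¬ne) = contradiction
          (finToFun-injective {w} {k} λ i → decidable-stable (a i ≟ b i) λ ne → ¬ne (i , ne)) c′≢c

-- Exhaustive search, and passage between families and instances.

-- The search runs over codes of functions, which recover a function only pointwise; hence P must
-- respect `≗`.
anyFunction? : {P : (Fin m → Fin n) → Set} → (∀ {f g} → f ≗ g → P f → P g) → (∀ f → Dec (P f)) → Dec (∃ P)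
anyFunction? resp P? = map′ (λ (s , p) → finToFun s , p)
  (λ (f , p) → funToFin f , resp (λ i → sym (finToFun-funToFin f i)) p) (any? λ s → P? (finToFun s))

module _ {d r} {R : Relation d r} (R? : Decidable R) where

  independent? : (y : Fin l → Vec (Fin n) r) → Dec (Independent R y)
  independent? y = all? λ c → anyFunction?
    (λ f≗g (¬s , s) → (λ t → ¬s (subst R (sym (map-cong f≗g (y c))) t)) ,
                      λ c′ ne → subst R (map-cong f≗g (y c′)) (s c′ ne))
    λ σ → ¬? (R? (map σ (y c))) ×-dec all? λ c′ → ¬? (c′ ≟ c) →-dec R? (map σ (y c′))

  Independent-resp : {y z : Fin l → Vec (Fin n) r} → y ≗ z → Independent R y → Independent R z
  Independent-resp y≗z ind c = let σ , ¬s , s = ind c in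
    σ , (λ t → ¬s (subst (Satisfies R σ) (sym (y≗z c)) t)) , λ c′ ne → subst (Satisfies R σ) (y≗z c′) (s c′ ne)

  -- Deciding each size l is what lets `greatest` produce the exact maximum constructively.
  anyIndependent? : ∀ n l → Dec (∃ λ (y : Fin l → Vec (Fin n) r) → Independent R y)
  anyIndependent? n l = map′
    (λ (s , ind) → toClause ∘ s , ind)
    (λ (y , ind) → (λ c → funToFin (lookup (y c))) , Independent-resp (λ c → sym (toClause-funToFin (y c))) ind)
    (anyFunction? (λ f≗g → Independent-resp (cong toClause ∘ f≗g)) λ s → independent? (toClause ∘ s))
    where
    toClause : Fin (n ^ r) → Vec (Fin n) r
    toClause s = tabulate (finToFun s)
    toClause-funToFin : ∀ v → toClause (funToFin (lookup v)) ≡ v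
    toClause-funToFin v = trans (tabulate-cong (finToFun-funToFin (lookup v))) (tabulate∘lookup v)

-- A clause repeated at a second index would be both violated and satisfied by the same assignment.
Independent⇒injective : (R : Relation d r) (y : Fin l → Vec (Fin n) r) → Independent R y →
                        ∀ {c c′} → y c ≡ y c′ → c ≡ c′
Independent⇒injective R y ind {c} {c′} e with c ≟ c′
... | yes c≡c′ = c≡c′
... | no c≢c′ = let σ , ¬s , s = ind c in
  contradiction (subst (Satisfies R σ) (sym e) (s c′ (c≢c′ ∘ sym))) ¬s

toInstance : (R : Relation d r) (y : Fin l → Vec (Fin n) r) → Independent R y →
             Σ (Instance n r) λ I → NonRedundant R I × size I ≡ l
toInstance {r = r} {n = n} R y ind = I , nonRedundant , length-tabulate y
  where
  I : Instance n r
  I = inst (List.tabulate y) (tabulate⁺ (Independent⇒injective R y ind))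
  nonRedundant : NonRedundant R I
  nonRedundant z z∈ with c , refl ← ∈-tabulate⁻ {f = y} z∈ = let σ , ¬s , s = ind c in
    σ , ¬s , λ z′ z′∈ ne → let c′ , e = ∈-tabulate⁻ {f = y} z′∈ in
      subst (Satisfies R σ) (sym e) (s c′ λ c′≡c → ne (trans e (cong y c′≡c)))

lookup-injective : ∀ {A : Set} {xs : List.List A} → Unique xs → ∀ {i j} → List.lookup xs i ≡ List.lookup xs j → i ≡ j
lookup-injective {xs = x List.∷ xs} (_ AllPairs.∷ _) {zero} {zero} e = refl
lookup-injective {xs = x List.∷ xs} (x∉ AllPairs.∷ _) {zero} {suc j} e = contradiction e (All.lookup x∉ (∈-lookup j))
lookup-injective {xs = x List.∷ xs} (x∉ AllPairs.∷ _) {suc i} {zero} e = contradiction (sym e) (All.lookup x∉ (∈-lookup i))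
lookup-injective {xs = x List.∷ xs} (_ AllPairs.∷ u) {suc i} {suc j} e = cong suc (lookup-injective u e)

fromInstance : (R : Relation d r) (I : Instance n r) → NonRedundant R I → Independent R (List.lookup (clauses I))
fromInstance R I nr c = let σ , ¬s , s = nr _ (∈-lookup c) in
  σ , ¬s , λ c′ ne → s _ (∈-lookup c′) (ne ∘ lookup-injective (distinct I))

-- Downward search: a failure at `suc b` lowers the bound to b, and at bound 0 the known witness o
-- must itself be 0.
greatest : {P : ℕ → Set} → Decidable P → ∀ {o} → P o → ∀ b → (∀ k → P k → k ≤ b) → ∃ λ m → P m × ∀ k → P k → k ≤ m
greatest P? {o} p zero    bound with refl ← n≤0⇒n≡0 (bound o p) = o , p , bound
greatest P? p (suc b) bound with P? (suc b)
... | yes p′ = suc b , p′ , bound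
... | no ¬p = greatest P? p b λ k pk → ≤-pred (≤∧≢⇒< (bound k pk) λ { refl → ¬p pk })

-- Cyclic windows and their row and column counts.

sum-rotate : ∀ n (f : ℕ → ℕ) → sum {n} (λ i → f (suc (toℕ i))) + f 0 ≡ sum {n} (λ i → f (toℕ i)) + f n
sum-rotate zero f = refl
sum-rotate (suc n) f = begin
  f 1 + S₂ + f 0        ≡⟨ e₁ (f 1) S₂ (f 0) ⟩
  f 0 + (S₂ + f 1)      ≡⟨ cong (f 0 +_) (sum-rotate n (f ∘ suc)) ⟩
  f 0 + (S₁ + f (suc n)) ≡⟨ +-assoc (f 0) S₁ _ ⟨
  f 0 + S₁ + f (suc n)  ∎
  where
  open ≡-Reasoning
  S₁ = sum {n} (λ i → f (suc (toℕ i)))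
  S₂ = sum {n} (λ i → f (suc (suc (toℕ i))))
  e₁ : ∀ a b c → a + b + c ≡ c + (b + a)
  e₁ = solve-∀

-- Induction on the shift: one more step trades the term `f s` for `f (n + s)`, which equals it by
-- periodicity.
sum-periodic : ∀ n (f : ℕ → ℕ) → (∀ x → f (x + n) ≡ f x) → ∀ s →
               sum {n} (λ i → f (toℕ i + s)) ≡ sum {n} (λ i → f (toℕ i))
sum-periodic n f per zero = sum-cong-≗ {n} λ i → cong f (+-identityʳ (toℕ i))
sum-periodic n f per (suc s) = +-cancelʳ-≡ (f s) _ _ (begin
  sum {n} (λ i → f (toℕ i + suc s)) + f s        ≡⟨ cong (_+ f s) (sum-cong-≗ {n} λ i → cong f (+-suc (toℕ i) s)) ⟩
  sum {n} (λ i → f (suc (toℕ i) + s)) + f s      ≡⟨ sum-rotate n (λ x → f (x + s)) ⟩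
  sum {n} (λ i → f (toℕ i + s)) + f (n + s)      ≡⟨ cong₂ _+_ (sum-periodic n f per s) (trans (cong f (+-comm n s)) (per s)) ⟩
  sum {n} (λ i → f (toℕ i)) + f s                ∎)
  where open ≡-Reasoning

sum-initial : ∀ n q → q ≤ n → sum {n} (λ i → indicator (toℕ i <ᵇ q)) ≡ q
sum-initial n zero _ = trans (sum-const n 0) (*-zeroʳ n)
sum-initial (suc n) (suc q) (s≤s q≤n) = cong suc (sum-initial n q q≤n)

-- The window of j starts at -j modulo p. This choice makes the formula symmetric in i and j, so
-- column counts reduce to row counts.
circulant : ∀ p .{{_ : NonZero p}} → ℕ → Fin p → Fin p → Bool
circulant p q j i = (toℕ i + toℕ j) % p <ᵇ q

circulant-row : ∀ p .{{_ : NonZero p}} q → q ≤ p → ∀ j → count (circulant p q j) ≡ q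
circulant-row p q q≤p j = begin
  sum {p} (λ i → f (toℕ i + toℕ j))          ≡⟨ sum-periodic p f (λ x → cong (λ z → indicator (z <ᵇ q)) ([m+n]%n≡m%n x p)) (toℕ j) ⟩
  sum {p} (λ i → f (toℕ i))                  ≡⟨ sum-cong-≗ {p} (λ i → cong (λ z → indicator (z <ᵇ q)) (m<n⇒m%n≡m (toℕ<n i))) ⟩
  sum {p} (λ i → indicator (toℕ i <ᵇ q))     ≡⟨ sum-initial p q q≤p ⟩
  q                                          ∎
  where
  open ≡-Reasoning
  f : ℕ → ℕ
  f x = indicator (x % p <ᵇ q)

circulant-column : ∀ p .{{_ : NonZero p}} q → q ≤ p → ∀ i → count (λ j → circulant p q j i) ≡ q
circulant-column p q q≤p i =
  trans (sum-cong-≗ {p} λ j → cong (λ x → indicator (x % p <ᵇ q)) (+-comm (toℕ i) (toℕ j))) (circulant-row p q q≤p i)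

-- Choice of the grid width and assembly of the two bounds.

n≤n^q : ∀ n q .{{_ : NonZero q}} → n ≤ n ^ q
n≤n^q zero    q = z≤n
n≤n^q n@(suc _) q = subst (_≤ n ^ q) (^-identityʳ n) (^-monoʳ-≤ n (>-nonZero⁻¹ q))

-- Take the largest w with `p * w ^ q ≤ n`. Since `p ≤ n`, w is at least 1, so `suc w ≤ 2 * w`, and
-- the failure of `suc w` gives the second bound at the cost of a factor `2 ^ q`.
root : ∀ p .{{_ : NonZero p}} q .{{_ : NonZero q}} n → p ≤ n → ∃ λ w → p * w ^ q ≤ n × n ≤ p * 2 ^ q * w ^ q
root p q n p≤n with greatest {P = λ w → p * w ^ q ≤ n} (λ w → p * w ^ q ≤? n) {1}
  (subst (_≤ n) (sym (trans (cong (p *_) (^-zeroˡ q)) (*-identityʳ p))) p≤n) n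
  (λ w h → ≤-trans (n≤n^q w q) (≤-trans (m≤n*m (w ^ q) p) h))
... | w , h , max = w , h , ≤-trans (<⇒≤ (≰⇒> λ h′ → n≮n w (max (suc w) h′)))
  (≤-trans (*-monoʳ-≤ p (^-monoˡ-≤ q suc-w≤)) (≤-reflexive (trans (cong (p *_) (^-distribʳ-* 2 w q)) (sym (*-assoc p _ _)))))
  where
  1≤w : 1 ≤ w
  1≤w = max 1 (subst (_≤ n) (sym (trans (cong (p *_) (^-zeroˡ q)) (*-identityʳ p))) p≤n)
  suc-w≤ : suc w ≤ 2 * w
  suc-w≤ = subst (suc w ≤_) (cong (w +_) (sym (+-identityʳ w))) (+-monoˡ-≤ w 1≤w)

module _ (p q′ : ℕ) .{{_ : NonZero p}} (q≤p : suc q′ ≤ p) where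
  private
    q = suc q′
    T = circulant p q
    covered : ∀ i → ∃ λ j → T j i ≡ true
    covered i = count-witness q′ _ (circulant-column p q q≤p i)
  open Masked T

  -- The total l is at most twice the larger class. The linear bound on conflicting clauses is
  -- absorbed through `n ^ q ≤ n ^ p`, which uses `q ≤ p` and n nonzero.
  size-upper : (y : Fin l → Vec (Fin n) p) .{{_ : NonZero n}} → Independent Projections y → l ^ q ≤ (2 * p) ^ q * n ^ p
  size-upper {l} {n} y ind with a , b , a+b≡l , a≤ , b≤ ← independent-≤ q′ (circulant-column p q q≤p) y ind | ≤-total a b
  ... | inj₁ a≤b = begin
      l ^ q                    ≡⟨ cong (_^ q) a+b≡l ⟨
      (a + b) ^ q              ≤⟨ ^-monoˡ-≤ q (+-monoˡ-≤ b a≤b) ⟩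
      (b + b) ^ q              ≡⟨ cong (λ x → (b + x) ^ q) (+-identityʳ b) ⟨
      (2 * b) ^ q              ≡⟨ ^-distribʳ-* 2 b q ⟩
      2 ^ q * b ^ q            ≤⟨ *-mono-≤ (^-monoˡ-≤ q (m≤m*n 2 p)) b≤ ⟩
      (2 * p) ^ q * n ^ p      ∎
    where open ≤-Reasoning
  ... | inj₂ b≤a = begin
      l ^ q                    ≡⟨ cong (_^ q) a+b≡l ⟨
      (a + b) ^ q              ≤⟨ ^-monoˡ-≤ q (+-monoʳ-≤ a b≤a) ⟩
      (a + a) ^ q              ≡⟨ cong (λ x → (a + x) ^ q) (+-identityʳ a) ⟨
      (2 * a) ^ q              ≤⟨ ^-monoˡ-≤ q (*-monoʳ-≤ 2 a≤) ⟩
      (2 * (n * p)) ^ q        ≡⟨ cong (λ x → (2 * x) ^ q) (*-comm n p) ⟩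
      (2 * (p * n)) ^ q        ≡⟨ cong (_^ q) (*-assoc 2 p n) ⟨
      (2 * p * n) ^ q          ≡⟨ ^-distribʳ-* (2 * p) n q ⟩
      (2 * p) ^ q * n ^ q      ≤⟨ *-monoʳ-≤ ((2 * p) ^ q) (^-monoʳ-≤ n q≤p) ⟩
      (2 * p) ^ q * n ^ p      ∎
    where open ≤-Reasoning

  -- The grid of width w from `root` is padded by e variables to reach exactly n. Raising
  -- `n ≤ p * 2 ^ q * w ^ q` to the power p compares n with the `w ^ p` clauses.
  size-lower : ∀ n → p ≤ n → ∃ λ l → (∃ λ (y : Fin l → Vec (Fin n) p) → Independent Projections y) ×
               n ^ p ≤ (p * 2 ^ q) ^ p * l ^ q
  size-lower n p≤n with w , h , h′ ← root p q n p≤n with e , refl ← m≤n⇒∃[o]m+o≡n h =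
    w ^ p , ((λ c → clauseOf T (circulant-row p q q≤p) covered w e (finToFun c)) ,
             grid-independent T (circulant-row p q q≤p) covered w e) , (begin
      n ^ p                                ≤⟨ ^-monoˡ-≤ p h′ ⟩
      (p * 2 ^ q * w ^ q) ^ p              ≡⟨ ^-distribʳ-* (p * 2 ^ q) (w ^ q) p ⟩
      (p * 2 ^ q) ^ p * (w ^ q) ^ p        ≡⟨ cong ((p * 2 ^ q) ^ p *_) (trans (^-*-assoc w q p)
                                                (trans (cong (w ^_) (*-comm q p)) (sym (^-*-assoc w p q)))) ⟩
      (p * 2 ^ q) ^ p * (w ^ p) ^ q        ∎)
    where open ≤-Reasoning

  nrd : ∀ n → p ≤ n → Σ ℕ λ m → IsNRD Projections n m × n ^ p ≤ (p * 2 ^ q) ^ p * m ^ q × m ^ q ≤ (2 * p) ^ q * n ^ p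
  nrd n p≤n = best-size ,
              (toInstance Projections (proj₁ best) (proj₂ best) ,
               λ I nr → max _ (List.lookup (clauses I) , fromInstance Projections I nr)) ,
              ≤-trans (proj₂ (proj₂ lower)) (*-monoʳ-≤ ((p * 2 ^ q) ^ p) (^-monoˡ-≤ q (max _ (proj₁ (proj₂ lower))))) ,
              size-upper (proj₁ best) (proj₂ best)
    where
    instance
      n≢0 : NonZero n
      n≢0 = >-nonZero (≤-trans (>-nonZero⁻¹ p) p≤n)
    Family : ℕ → Set
    Family l = ∃ λ (y : Fin l → Vec (Fin n) p) → Independent Projections y
    lower : ∃ λ l → Family l × n ^ p ≤ (p * 2 ^ q) ^ p * l ^ q
    lower = size-lower n p≤n
    search : ∃ λ m → Family m × ∀ l → Family l → l ≤ m
    -- The crude estimate `l ≤ l ^ q` turns the upper bound into a finite range for the search.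
    search = greatest (anyIndependent? projections? n) (proj₁ (proj₂ lower)) ((2 * p) ^ q * n ^ p)
      λ l (y , ind) → ≤-trans (n≤n^q l q) (size-upper y ind)
    best-size = proj₁ search
    best = proj₁ (proj₂ search)
    max = proj₂ (proj₂ search)

theorem1p1 : (p q : ℕ) → .{{NonZero p}} → .{{NonZero q}} → q ≤ p →
    Σ ℕ λ d → Σ ℕ λ r → NonZero r × Σ (Relation d r) λ R →
    Σ ℕ λ A → Σ ℕ λ B → NonZero A × NonZero B × Σ ℕ λ N →
    (n : ℕ) → N ≤ n →
    Σ ℕ λ m → IsNRD R n m × (n ^ p ≤ A * m ^ q) × (m ^ q ≤ B * n ^ p)
theorem1p1 p@(suc _) q@(suc q′) q≤p =
  -- Domain elements code p bits, one entry per window. The threshold is p, where the grid width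
  -- first becomes positive.
  2 ^ p , p , _ , Masked.Projections (circulant p q) , (p * 2 ^ q) ^ p , (2 * p) ^ q ,
  m^n≢0 (p * 2 ^ q) p {{m*n≢0 p (2 ^ q) {{_}} {{m^n≢0 2 q}}}} , m^n≢0 (2 * p) q , p , nrd p q′ q≤p
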